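{- Let $\mathcal{S}$ be a nonempty set with a scene space basis $\mathcal{B}$ and let $P$ be a program over $\mathcal{S}$. Then $BV(P)$ is the smallest set of variables satisfying the bound effect property for $P$. That is: (1) for all $s,s'\in\mathcal{S}$, $P(s,s')$ implies $s\approx s'$ on $(\bigcup BV(P))^{\complement}$; and (2) if $T\subseteq\mathcal{B}$ is such that for all $s,s'\in\mathcal{S}$, $P(s,s')$ implies $s\approx s'$ on $(\bigcup T)^{\complement}$, then $BV(P)\subseteq T$.
   Context: Scenes. Let $\mathcal{S}$ be a nonempty set (of states). A scene on $\mathcal{S}$ is a function $A:\mathcal{S}\to\mathcal{S}\to\mathcal{S}$ satisfying for all $x,y,z$: $A\,(A\,x\,y)\,z = A\,x\,z$, $A\,x\,(A\,y\,z)=A\,x\,z$, $A\,x\,x=x$. Write $\bot = (\lambda s_1\,s_2.\ s_1)$, $\top=(\lambda s_1\,s_2.\ s_2)$, $A^{\complement}=(\lambda s_1\,s_2.\ A\,s_2\,s_1)$, $A\sqcup B=(\lambda s_1\,s_2.\ B\,(A\,s_1\,s_2)\,s_2)$. Scenes $A,B$ are independent if $B\,(A\,s_1\,s_2)\,s_3=A\,(B\,s_1\,s_3)\,s_2$ for all $s_1,s_2,s_3$. Write "$s_1\approx s_2$ on $A$" for $A\,s_1\,s_2=s_1$. A scene space basis is a finite sequence of scenes $S_1,\dots,S_n$ with $S_i,S_j$ independent for $i\neq j$ and $S_1\sqcup\cdots\sqcup S_n=\top$; $\mathcal{B}=\{S_1,\dots,S_n\}$ (the variables). For a set $X\subseteq\mathcal{B}$,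 $\bigcup X$ denotes the $\sqcup$ of all its elements (in any order, the result being independent of it), with $\bigcup\emptyset=\bot$. A program is a binary predicate $P(s,s')$ on $\mathcal{S}$. Bound variables: $BV(P)=\{x\in\mathcal{B} : \exists s_0,s_0'.\ P(s_0,s_0') \text{ and not } (s_0\approx s_0' \text{ on } x)\}$. -}

module Defs where

open import Algebra.Core using (Op₂)
open import Axiom.ExcludedMiddle using (ExcludedMiddle)
open import Data.Fin.Base using (Fin)
open import Data.List.Base using (List; foldr; filter; tabulate)
open import Data.Nat.Base using (ℕ)
open import Data.Product.Base using (_×_; _,_; ∃; ∃₂; ∃-syntax)
open import Level using (Level; suc)
open import Relation.Binary.Core using (Rel)
open import Relation.Binary.Definitions using (_Respects_)
open import Relation.Binary.PropositionalEquality
  using (_≡_; _≢_; refl; sym; trans; cong)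
open import Relation.Nullary using (¬_)
open import Relation.Unary using (Pred; _⊆_)

private
  variable
    ℓ : Level
    S : Set ℓ

infix  4 _≐_ _≈_on_
infixr 6 _⊔_
infix  8 _^∁

-- Equality of scenes is equality of functions, hence pointwise here.
_≐_ : {S : Set ℓ} → Rel (Op₂ S) ℓ
A ≐ B = ∀ s₁ s₂ → A s₁ s₂ ≡ B s₁ s₂

record IsScene {S : Set ℓ} (A : Op₂ S) : Set ℓ where
  field
    overrideˡ  : ∀ x y z → A (A x y) z ≡ A x z
    overrideʳ  : ∀ x y z → A x (A y z) ≡ A x z
    idempotent : ∀ x → A x x ≡ x

⊥ : Op₂ S
⊥ s₁ s₂ = s₁

⊤ : Op₂ S
⊤ s₁ s₂ = s₂

_^∁ : Op₂ S → Op₂ S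
(A ^∁) s₁ s₂ = A s₂ s₁

_⊔_ : Op₂ S → Op₂ S → Op₂ S
(A ⊔ B) s₁ s₂ = B (A s₁ s₂) s₂

⨆ : List (Op₂ S) → Op₂ S
⨆ = foldr _⊔_ ⊥

Independent : {S : Set ℓ} → Rel (Op₂ S) ℓ
Independent A B = ∀ s₁ s₂ s₃ → B (A s₁ s₂) s₃ ≡ A (B s₁ s₃) s₂

_≈_on_ : {S : Set ℓ} → S → S → Op₂ S → Set ℓ
s₁ ≈ s₂ on A = A s₁ s₂ ≡ s₁

record SceneSpaceBasis (S : Set ℓ) : Set ℓ where
  field
    size        : ℕ
    scene       : Fin size → Op₂ S
    isScene     : ∀ i → IsScene (scene i)
    independent : ∀ i j → i ≢ j → Independent (scene i) (scene j)
    spanning    : ⨆ (tabulate scene) ≐ ⊤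

open SceneSpaceBasis

Variable : {S : Set ℓ} → SceneSpaceBasis S → Pred (Op₂ S) ℓ
Variable 𝓑 A = ∃[ i ] A ≐ scene 𝓑 i

-- A predicate on scenes describes a set of scenes only if it does not
-- distinguish pointwise equal scenes.
record IsVariableSet {S : Set ℓ} (𝓑 : SceneSpaceBasis S)
                     (X : Pred (Op₂ S) ℓ) : Set (suc ℓ) where
  field
    respects  : X Respects _≐_
    variables : X ⊆ Variable 𝓑

-- A scene may occur at several positions i ≢ j of the sequence and is then
-- independent of itself.  By this lemma it is ⊥, the unit of _⊔_, so the
-- repetitions do not affect ⋃ below.
self-independent⇒⊥ : {A : Op₂ S} → IsScene A → Independent A A → A ≐ ⊥
self-independent⇒⊥ {A = A} isS ind s₁ s₂ =
  trans (sym (cong (λ s → A s s₂) (idempotent s₁)))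
  (trans (sym (ind s₁ s₂ s₁))
  (trans (overrideˡ s₁ s₂ s₁) (idempotent s₁)))
  where open IsScene isS

-- The set X is arbitrary, so excluded middle is needed to select its elements.
⋃ : {S : Set ℓ} → ExcludedMiddle ℓ → SceneSpaceBasis S →
    Pred (Op₂ S) ℓ → Op₂ S
⋃ em 𝓑 X = ⨆ (filter {P = X} (λ _ → em) (tabulate (scene 𝓑)))

Program : Set ℓ → Set (suc ℓ)
Program {ℓ} S = Rel S ℓ

BV : {S : Set ℓ} → SceneSpaceBasis S → Program S → Pred (Op₂ S) ℓ
BV 𝓑 P x = Variable 𝓑 x × ∃₂ λ s₀ s₀′ → P s₀ s₀′ × ¬ (s₀ ≈ s₀′ on x)

BV-isVariableSet : {S : Set ℓ} (𝓑 : SceneSpaceBasis S) (P : Program S) →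
                   IsVariableSet 𝓑 (BV 𝓑 P)
BV-isVariableSet 𝓑 P = record
  { respects  = λ { x≐y ((i , x≐i) , s , s′ , p , ≉) →
      (i , λ s₁ s₂ → trans (sym (x≐y s₁ s₂)) (x≐i s₁ s₂)) ,
      s , s′ , p , λ ≈ → ≉ (trans (x≐y s s′) ≈) }
  ; variables = λ { (v , _) → v }
  }

BoundEffect : {S : Set ℓ} → ExcludedMiddle ℓ → SceneSpaceBasis S →
              Program S → Pred (Op₂ S) ℓ → Set ℓ
BoundEffect em 𝓑 P X = ∀ s s′ → P s s′ → s ≈ s′ on (⋃ em 𝓑 X ^∁)

{-# OPTIONS --safe #-}

-- Everything rests on one remark: if B is independent of A, then overriding t
-- by B does not destroy A t u ≡ t.  For (1), fix P s s′.  A variable A outside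
-- BV satisfies A s′ s ≡ s′, so it acts trivially on every state reached from
-- s′ by overriding with s on other variables.  Hence ⋃ BV and the join of all
-- variables, which is ⊤, agree at s′ and s.  For (2), a variable A ∉ T is
-- independent of every member of T, so A s′ s′ ≡ s′ is carried along to
-- A s s′ ≡ s, where s = ⋃ T s′ s.
module Submission where

open import Defs
open import Level using (Level)
open import Algebra.Core using (Op₂)
open import Axiom.ExcludedMiddle using (ExcludedMiddle)
open import Data.Fin.Properties using (_≟_)
open import Data.List.Base using (List; []; _∷_; filter; tabulate)
open import Data.List.Relation.Unary.All as All using (All; []; _∷_)
open import Data.List.Relation.Unary.All.Properties
  using (all-filter; filter⁺; tabulate⁺)
open import Data.List.Relation.Unary.AllPairs using (AllPairs; []; _∷_)
open import Data.List.Relation.Unary.AllPairs.Properties as AllPairs using ()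
open import Data.Product.Base using (_×_; _,_)
open import Function.Base using (_∘_)
open import Relation.Binary.PropositionalEquality
  using (_≡_; refl; sym; trans; cong; subst)
open import Relation.Nullary using (¬_; yes; no; contradiction)
open import Relation.Nullary.Decidable using (decidable-stable)
open import Relation.Unary using (Pred; Decidable; _⊆_)

private
  variable
    ℓ : Level
    S : Set ℓ
    A : Op₂ S
    s t u : S

open SceneSpaceBasis

Independent-sym : (A B : Op₂ S) → Independent A B → Independent B A
Independent-sym A B ind s₁ s₂ s₃ = sym (ind s₁ s₃ s₂)

override-fixed : (A B : Op₂ S) → Independent A B →
                 A t u ≡ t → A (B t s) u ≡ B t s
override-fixed {t = t} {u = u} {s = s} A B ind fixed =
  trans (sym (ind t u s)) (cong (λ r → B r s) fixed)

⨆-fixed : (A : Op₂ S) {L : List (Op₂ S)} → All (Independent A) L →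
          A t u ≡ t → A (⨆ L t s) u ≡ ⨆ L t s
⨆-fixed A []                       fixed = fixed
⨆-fixed A {L = B ∷ _} (ind ∷ inds) fixed =
  ⨆-fixed A inds (override-fixed A B ind fixed)

-- The induction varies `t`: once the head `A` is kept, the rest of the join starts from `A t s`,
-- and independence from `A` carries the remaining hypotheses there.
⨆-filter : {X : Pred (Op₂ S) ℓ} (X? : Decidable X) {L : List (Op₂ S)} →
           AllPairs Independent L → All (λ A → ¬ X A → A t s ≡ t) L →
           ⨆ (filter X? L) t s ≡ ⨆ L t s
⨆-filter X? [] [] = refl
⨆-filter {t = t} {s = s} {X = X} X? {A ∷ L} (inds ∷ pairs) (fixed ∷ fixeds)
  with X? A
... | yes _ = ⨆-filter X? pairs (All.zipWith step (inds , fixeds))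
  where
  step : ∀ {C} → Independent A C × (¬ X C → C t s ≡ t) →
         ¬ X C → C (A t s) s ≡ A t s
  step {C} (ind , fixed) =
    override-fixed C A (Independent-sym A C ind) ∘ fixed
... | no ∉X = trans (⨆-filter X? pairs fixeds)
                    (cong (λ r → ⨆ L r s) (sym (fixed ∉X)))

-- `A t s` equals `A t (A s t)`, which collapses to `A t t`.
≈-on-sym : IsScene A → s ≈ t on A → t ≈ s on A
≈-on-sym {A = A} {s = s} {t = t} isS s≈t =
  trans (cong (A t) (sym s≈t)) (trans (overrideʳ t s t) (idempotent t))
  where open IsScene isS

BV-boundEffect : (em : ExcludedMiddle ℓ) {S : Set ℓ}
                 (𝓑 : SceneSpaceBasis S) (P : Program S) →
                 BoundEffect em 𝓑 P (BV 𝓑 P)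
BV-boundEffect em 𝓑 P s s′ p =
  -- The complement swaps the arguments, so the goal is `⋃ em 𝓑 (BV 𝓑 P) s′ s ≡ s`.
  trans (⨆-filter (λ _ → em)
          (AllPairs.tabulate⁺ (independent 𝓑 _ _)) (tabulate⁺ fixed))
        (spanning 𝓑 s′ s)
  where
  fixed : ∀ i → ¬ BV 𝓑 P (scene 𝓑 i) → scene 𝓑 i s′ s ≡ s′
  fixed i ∉BV = ≈-on-sym (isScene 𝓑 i) (decidable-stable em λ s≉s′ →
    ∉BV ((i , λ _ _ → refl) , s , s′ , p , s≉s′))

BV-least : (em : ExcludedMiddle ℓ) {S : Set ℓ}
           (𝓑 : SceneSpaceBasis S) (P : Program S)
           {T : Pred (Op₂ S) ℓ} → IsVariableSet 𝓑 T →
           BoundEffect em 𝓑 P T → BV 𝓑 P ⊆ T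
BV-least em 𝓑 P {T} isT effect {x} ((i , x≐i) , s , s′ , p , s≉s′) =
  -- `x` is only pointwise equal to `scene 𝓑 i`; since `T` respects this equality, `scene 𝓑 i` lies
  -- outside `T` as well.
  decidable-stable em λ x∉T →
    s≉s′ (trans (x≐i s s′)
      (unaffected (x∉T ∘ respects λ s₁ s₂ → sym (x≐i s₁ s₂))))
  where
  open IsVariableSet isT

  module _ (i∉T : ¬ T (scene 𝓑 i)) where

    -- Membership in `T` rules out `j = i`, the one case where the basis gives no independence.
    independent-of-T : ∀ j → T (scene 𝓑 j) →
                       Independent (scene 𝓑 i) (scene 𝓑 j)
    independent-of-T j j∈T with i ≟ j
    ... | yes refl = contradiction j∈T i∉T
    ... | no  i≢j  = independent 𝓑 i j i≢j

    independents : All (Independent (scene 𝓑 i))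
                       (filter {P = T} (λ _ → em) (tabulate (scene 𝓑)))
    -- Membership in `T` holds only after filtering, so independence passes through the filter as an
    -- implication and is discharged afterwards.
    independents = All.zipWith (λ (f , j∈T) → f j∈T)
      ( filter⁺ (λ _ → em) {Q = λ A → T A → Independent (scene 𝓑 i) A}
          (tabulate⁺ independent-of-T)
      , all-filter (λ _ → em) (tabulate (scene 𝓑)))

    unaffected : s ≈ s′ on scene 𝓑 i
    unaffected =
      subst (_≈ s′ on scene 𝓑 i) (effect s s′ p)
        (⨆-fixed (scene 𝓑 i) independents
          (IsScene.idempotent (isScene 𝓑 i) s′))

lemma38 : ∀ {ℓ : Level} (em : ExcludedMiddle ℓ) (S : Set ℓ) → S →
    (𝓑 : SceneSpaceBasis S) (P : Program S) →
    BoundEffect em 𝓑 P (BV 𝓑 P) ×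
    (∀ (T : Pred (Op₂ S) ℓ) → IsVariableSet 𝓑 T →
    BoundEffect em 𝓑 P T → BV 𝓑 P ⊆ T)
lemma38 em S _ 𝓑 P =
  BV-boundEffect em 𝓑 P , λ T → BV-least em 𝓑 P
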